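{- Let $G=(V,E)$ be a simple graph and let $e=\{u,v\}\in E$ be an edge with $N[v]=N[u]$. If there exists a support vertex $w\in N[u]$, then the edge $e$ is an irrelevant edge of $G$, i.e. $D_t(G,x)=D_t(G\setminus e,x)$.
   Context: For a simple graph $G=(V,E)$, $N(v)$ is the set of neighbors of $v$ and $N[v]=N(v)\cup\{v\}$. A leaf is a vertex of degree one; a support vertex is a vertex adjacent to a leaf. A set $D\subseteq V$ is a total dominating set if every vertex of $V$ is adjacent to some vertex of $D$. $d_t(G,i)$ is the number of total dominating sets of $G$ of cardinality $i$, and $D_t(G,x)=\sum_i d_t(G,i)x^i$ is the total domination polynomial of $G$. $G\setminus e$ denotes $G$ with the edge $e$ deleted (vertices kept). An edge $e$ of $G$ is called irrelevant if $D_t(G,x)=D_t(G\setminus e,x)$.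
   Formalization: The formal theorem adds the hypothesis N[u] ≠ {u,v}, i.e. e is not a K_2 component; without it the claim fails for G = K_2, where D_t(G,x) = x^2 but D_t(G∖e,x) = 0. -}

module Defs where

open import Level using (0ℓ)
open import Data.Nat using (ℕ; zero; suc)
import Data.Nat as ℕ
open import Data.Fin using (Fin; toℕ; _≟_)
open import Data.Fin.Properties using (all?; any?)
open import Data.Fin.Subset using (Subset; inside; outside; _∈_; _∪_; ⁅_⁆; ∣_∣)
open import Data.Fin.Subset.Properties using (_∈?_)
open import Data.List using (List; _++_; length; filter)
import Data.List as List
open import Data.Product using (_×_; _,_; ∃-syntax)
open import Data.Sum using (_⊎_; inj₁; inj₂)
open import Data.Vec using (Vec; []; _∷_; tabulate)
open import Function using (_∘_)
open import Relation.Binary using (Rel; Decidable; Symmetric; Irreflexive)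
open import Relation.Binary.PropositionalEquality using (_≡_)
open import Relation.Nullary using (Dec; ¬_; does)
open import Relation.Nullary.Decidable using (_×-dec_; _⊎-dec_; ¬?)

record SimpleGraph (n : ℕ) : Set₁ where
  field
    Adj    : Rel (Fin n) 0ℓ
    adj?   : Decidable Adj
    sym    : Symmetric Adj
    irrefl : Irreflexive _≡_ Adj

open SimpleGraph public using (Adj; adj?)

N : ∀ {n} → SimpleGraph n → Fin n → Subset n
N G v = tabulate (λ w → does (adj? G v w))

N[_] : ∀ {n} → SimpleGraph n → Fin n → Subset n
N[ G ] v = N G v ∪ ⁅ v ⁆

degree : ∀ {n} → SimpleGraph n → Fin n → ℕ
degree G v = ∣ N G v ∣

Leaf : ∀ {n} → SimpleGraph n → Fin n → Set
Leaf G v = degree G v ≡ 1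

Support : ∀ {n} → SimpleGraph n → Fin n → Set
Support G v = ∃[ w ] (Adj G v w × Leaf G w)

-- x and y are the two ends of the unordered pair {u , v}.
Ends : ∀ {n} → Fin n → Fin n → Rel (Fin n) 0ℓ
Ends u v x y = (x ≡ u × y ≡ v) ⊎ (x ≡ v × y ≡ u)

ends? : ∀ {n} (u v : Fin n) → Decidable (Ends u v)
ends? u v x y = ((x ≟ u) ×-dec (y ≟ v)) ⊎-dec ((x ≟ v) ×-dec (y ≟ u))

ends-sym : ∀ {n} (u v : Fin n) → Symmetric (Ends u v)
ends-sym u v (inj₁ (p , q)) = inj₂ (q , p)
ends-sym u v (inj₂ (p , q)) = inj₁ (q , p)

infixl 6 _∖⟨_,_⟩

_∖⟨_,_⟩ : ∀ {n} → SimpleGraph n → Fin n → Fin n → SimpleGraph n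
G ∖⟨ u , v ⟩ = record
  { Adj    = λ x y → Adj G x y × ¬ Ends u v x y
  ; adj?   = λ x y → adj? G x y ×-dec ¬? (ends? u v x y)
  ; sym    = λ (a , ne) → SimpleGraph.sym G a , ne ∘ ends-sym u v
  ; irrefl = λ eq (a , _) → SimpleGraph.irrefl G eq a
  }

TotalDominating : ∀ {n} → SimpleGraph n → Subset n → Set
TotalDominating G D = ∀ v → ∃[ w ] (w ∈ D × Adj G v w)

totalDominating? : ∀ {n} (G : SimpleGraph n) (D : Subset n) → Dec (TotalDominating G D)
totalDominating? G D = all? λ v → any? λ w → (w ∈? D) ×-dec adj? G v w

-- Every subset of Fin n occurs exactly once.
allSubsets : ∀ n → List (Subset n)
allSubsets zero    = List.[ [] ]
allSubsets (suc n) =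
  List.map (inside ∷_) (allSubsets n) ++ List.map (outside ∷_) (allSubsets n)

dₜ : ∀ {n} → SimpleGraph n → ℕ → ℕ
dₜ {n} G i =
  length (filter (λ D → totalDominating? G D ×-dec (∣ D ∣ ℕ.≟ i)) (allSubsets n))

-- Polynomials of degree at most n with coefficients in ℕ, as coefficient vectors:
-- the entry at index i is the coefficient of xⁱ.
Poly≤ : ℕ → Set
Poly≤ n = Vec ℕ (suc n)

-- Degree n suffices, since no subset of Fin n has more than n elements.
Dₜ : ∀ {n} → SimpleGraph n → Poly≤ n
Dₜ G = tabulate (λ i → dₜ G (toℕ i))

IrrelevantEdge : ∀ {n} → SimpleGraph n → Fin n → Fin n → Set
IrrelevantEdge G u v = Dₜ G ≡ Dₜ (G ∖⟨ u , v ⟩)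

{-# OPTIONS --safe #-}
module Submission where

-- A leaf at u would, since u and v have the same closed neighbourhood, either be
-- v, forcing N[u] = {u, v}, or be adjacent to both u and v. So w is neither u nor v
-- and is a common neighbour of both. Being a support vertex it lies in every total
-- dominating set, where it dominates u and v without the edge uv.

open import Defs
open import Data.Empty using (⊥)
open import Data.Nat using (ℕ)
import Data.Nat as ℕ
open import Data.Nat.Properties using (<⇒≱; ≤-trans; ≤-reflexive)
open import Data.Bool.Properties using (T-≡)
open import Data.Fin using (Fin; toℕ; _≟_)
open import Data.Fin.Subset using (Subset; _∈_; _∪_; _-_; ⁅_⁆; ∣_∣)
open import Data.Fin.Subset.Properties
  using (⊆-antisym; x∈p∪q⁺; x∈p∪q⁻; x∈⁅x⁆; x∈⁅y⁆⇒x≡y; x∈p⇒∣p-x∣<∣p∣; x∈p∧x≢y⇒x∈p-y; ∪-comm)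
open import Data.List using (length)
open import Data.List.Properties using (filter-≐)
open import Data.Product using (_×_; _,_; map₁)
open import Data.Sum using (inj₁; inj₂)
open import Data.Vec.Properties using (lookup∘tabulate; lookup⇒[]=; []=⇒lookup; tabulate-cong)
open import Function.Base using (_∘_)
open import Function.Bundles using (Equivalence)
open import Relation.Binary.PropositionalEquality
  using (_≡_; _≢_; refl; sym; trans; subst; cong; ≢-sym)
open import Relation.Nullary using (Dec; yes; no; contradiction)
open import Relation.Nullary.Decidable using (_×-dec_; dec-true; isYes≗does; toWitness; decidable-stable)

∣p∣≡1⇒unique : ∀ {n} {p : Subset n} {x y} → ∣ p ∣ ≡ 1 → x ∈ p → y ∈ p → x ≡ y
∣p∣≡1⇒unique {x = x} {y} ∣p∣≡1 x∈p y∈p = decidable-stable (x ≟ y) λ x≢y →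
  -- If `x` and `y` differ, `y` survives in `p - x`, and removing it as well shows `1 ≤ ∣ p - x ∣`,
  -- against `∣ p - x ∣ < ∣ p ∣ = 1`.
  <⇒≱ (x∈p⇒∣p-x∣<∣p∣ x∈p)
      (≤-trans (≤-reflexive ∣p∣≡1)
               (≤-trans (ℕ.s≤s ℕ.z≤n) (x∈p⇒∣p-x∣<∣p∣ (x∈p∧x≢y⇒x∈p-y y∈p (≢-sym x≢y)))))

module _ {n} (G : SimpleGraph n) where

  Adj⇒∈N : ∀ {x y} → Adj G x y → y ∈ N G x
  Adj⇒∈N {x} {y} a =
    lookup⇒[]= y (N G x) (trans (lookup∘tabulate _ y) (dec-true (adj? G x y) a))

  ∈N⇒Adj : ∀ {x y} → y ∈ N G x → Adj G x y
  -- `N` is tabulated with `does`, while `toWitness` consumes `isYes`; `isYes≗does` bridges the two.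
  ∈N⇒Adj {x} {y} y∈N = toWitness {a? = adj? G x y}
    (Equivalence.from T-≡
      (trans (isYes≗does (adj? G x y)) (trans (sym (lookup∘tabulate _ y)) ([]=⇒lookup y∈N))))

  Adj⇒∈N[] : ∀ {x y} → Adj G x y → y ∈ N[ G ] x
  Adj⇒∈N[] = x∈p∪q⁺ ∘ inj₁ ∘ Adj⇒∈N

  ∈N[]∧≢⇒Adj : ∀ {x y} → y ∈ N[ G ] x → y ≢ x → Adj G x y
  ∈N[]∧≢⇒Adj {x} y∈N[x] y≢x with x∈p∪q⁻ (N G x) ⁅ x ⁆ y∈N[x]
  ... | inj₁ y∈N = ∈N⇒Adj y∈N
  ... | inj₂ y∈x = contradiction (x∈⁅y⁆⇒x≡y x y∈x) y≢x

  Adj⇒≢ : ∀ {x y} → Adj G x y → x ≢ y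
  Adj⇒≢ a x≡y = SimpleGraph.irrefl G x≡y a

  leaf-unique : ∀ {l x y} → Leaf G l → Adj G l x → Adj G l y → x ≡ y
  leaf-unique leaf a b = ∣p∣≡1⇒unique leaf (Adj⇒∈N a) (Adj⇒∈N b)

  leaf-N[] : ∀ {l x} → Leaf G l → Adj G l x → N[ G ] l ≡ ⁅ x ⁆ ∪ ⁅ l ⁆
  leaf-N[] {l} {x} leaf a = ⊆-antisym to from
    where
    to : ∀ {y} → y ∈ N[ G ] l → y ∈ ⁅ x ⁆ ∪ ⁅ l ⁆
    to y∈ with x∈p∪q⁻ (N G l) ⁅ l ⁆ y∈
    ... | inj₁ y∈N rewrite leaf-unique leaf (∈N⇒Adj y∈N) a = x∈p∪q⁺ (inj₁ (x∈⁅x⁆ x))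
    ... | inj₂ y∈l = x∈p∪q⁺ (inj₂ y∈l)
    from : ∀ {y} → y ∈ ⁅ x ⁆ ∪ ⁅ l ⁆ → y ∈ N[ G ] l
    from y∈ with x∈p∪q⁻ ⁅ x ⁆ ⁅ l ⁆ y∈
    ... | inj₁ y∈x rewrite x∈⁅y⁆⇒x≡y x y∈x = Adj⇒∈N[] a
    ... | inj₂ y∈l = x∈p∪q⁺ (inj₂ y∈l)

  twin-¬support : ∀ {u v} → Adj G u v → N[ G ] v ≡ N[ G ] u →
    N[ G ] u ≢ ⁅ u ⁆ ∪ ⁅ v ⁆ → Support G u → ⊥
  twin-¬support {u} {v} uv Nv≡Nu Nu≢uv (l , ul , leaf) with l ≟ v
  ... | yes refl = Nu≢uv (trans (sym Nv≡Nu) (leaf-N[] leaf (SimpleGraph.sym G uv)))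
  ... | no l≢v = Adj⇒≢ uv (leaf-unique leaf (SimpleGraph.sym G ul) (SimpleGraph.sym G vl))
    where
    vl : Adj G v l
    vl = ∈N[]∧≢⇒Adj (subst (l ∈_) (sym Nv≡Nu) (Adj⇒∈N[] ul)) l≢v

  -- The leaf has to be dominated, and its only neighbour is the support vertex.
  support∈totalDominating : ∀ {w D} → Support G w → TotalDominating G D → w ∈ D
  support∈totalDominating {D = D} (l , wl , leaf) td with td l
  ... | x , x∈D , lx = subst (_∈ D) (leaf-unique leaf lx (SimpleGraph.sym G wl)) x∈D

  -- A vertex keeps its dominator unless the two are joined by the deleted edge. That happens only
  -- at `u` and `v`, where `w` takes over.
  commonNeighbour-totalDominating : ∀ {u v w D} → Adj G u w → Adj G v w → w ∈ D →
    TotalDominating G D → TotalDominating (G ∖⟨ u , v ⟩) D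
  commonNeighbour-totalDominating {u} {v} {w} uw vw w∈D td x with td x
  ... | y , y∈D , xy with ends? u v x y
  ... | no ¬e = y , y∈D , xy , ¬e
  -- The edge to `w` survives the deletion because `w`, being adjacent to both `u` and `v`, is
  -- neither of them.
  ... | yes (inj₁ (refl , _)) = w , w∈D , uw , λ where
    (inj₁ (_ , w≡v)) → Adj⇒≢ vw (sym w≡v)
    (inj₂ (_ , w≡u)) → Adj⇒≢ uw (sym w≡u)
  ... | yes (inj₂ (refl , _)) = w , w∈D , vw , λ where
    (inj₁ (_ , w≡v)) → Adj⇒≢ vw (sym w≡v)
    (inj₂ (_ , w≡u)) → Adj⇒≢ uw (sym w≡u)

  ∖-totalDominating : ∀ {u v D} → TotalDominating (G ∖⟨ u , v ⟩) D → TotalDominating G D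
  ∖-totalDominating td x with td x
  ... | y , y∈D , xy , _ = y , y∈D , xy

-- Every coefficient filters the same list of subsets, so equivalent predicates select the same
-- sublist for each cardinality.
Dₜ-cong : ∀ {n} (G H : SimpleGraph n) →
  (∀ {D} → TotalDominating G D → TotalDominating H D) →
  (∀ {D} → TotalDominating H D → TotalDominating G D) → Dₜ G ≡ Dₜ H
Dₜ-cong {n} G H to from = tabulate-cong λ i → cong length
  (filter-≐ (counted? G (toℕ i)) (counted? H (toℕ i)) (map₁ to , map₁ from) (allSubsets n))
  where
  -- This repeats the decision procedure inside `dₜ`, so that the filtered lists match by
  -- definition.
  counted? : ∀ (K : SimpleGraph n) i (D : Subset n) → Dec (TotalDominating K D × ∣ D ∣ ≡ i)
  counted? K i D = totalDominating? K D ×-dec (∣ D ∣ ℕ.≟ i)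

-- If `N[ G ] u` were `⁅ u ⁆ ∪ ⁅ v ⁆`, the edge would be a whole component, and deleting it would
-- isolate `u` and `v` and leave no total dominating set. The inequality rules this out.
theorem2p5 : ∀ {n : ℕ} (G : SimpleGraph n) (u v : Fin n) → Adj G u v →
    N[ G ] v ≡ N[ G ] u →
    N[ G ] u ≢ ⁅ u ⁆ ∪ ⁅ v ⁆ →
    (w : Fin n) → w ∈ N[ G ] u → Support G w →
    IrrelevantEdge G u v
theorem2p5 G u v uv Nv≡Nu Nu≢uv w w∈Nu support =
  Dₜ-cong G (G ∖⟨ u , v ⟩)
    (λ td → commonNeighbour-totalDominating G
      (∈N[]∧≢⇒Adj G w∈Nu w≢u)
      (∈N[]∧≢⇒Adj G (subst (w ∈_) (sym Nv≡Nu) w∈Nu) w≢v)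
      (support∈totalDominating G support td) td)
    (∖-totalDominating G)
  where
  w≢u : w ≢ u
  w≢u refl = twin-¬support G uv Nv≡Nu Nu≢uv support
  w≢v : w ≢ v
  -- The same argument with `u` and `v` exchanged; the inequality is carried over to `N[ G ] v` and
  -- the union commuted.
  w≢v refl = twin-¬support G (SimpleGraph.sym G uv) (sym Nv≡Nu)
    (λ eq → Nu≢uv (trans (sym Nv≡Nu) (trans eq (∪-comm ⁅ v ⁆ ⁅ u ⁆)))) support
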